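{- For each $n>1$, there exists an NBW $\mathcal{B}_n$ with $n$ states over a seven-letter alphabet such that $L(n)\leq C_{\mathrm{NBW}}(\mathcal{B}_n)$.
   Context: An NBW is $(\Sigma,S,I,\Delta,F)$ with finite $\Sigma$, finite $S$, $I,F\subseteq S$, $\Delta\subseteq S\times\Sigma\times S$; $\alpha\in\Sigma^\omega$ is accepted if there is a run $\rho(0)\rho(1)\cdots$ with $\rho(0)\in I$, $\langle\rho(i),\alpha(i),\rho(i+1)\rangle\in\Delta$ for all $i$, visiting $F$ infinitely often. $C_{\mathrm{NBW}}(\mathcal{A})$ is the minimum number of states of an NBW over the same alphabet accepting $\Sigma^\omega\setminus\mathcal{L}(\mathcal{A})$. For $n>1$ let $S'_n$ be a set of $n-1$ elements; for $1\le m<n$, a $Q(m)$-ranking is a function $h:S'_n\to\{0,1,\dots,2m-1\}$ such that every odd number $1,3,\dots,2m-1$ is a value of $h$; $L(n,m)$ is the number of $Q(m)$-rankings and $L(n)=\max_{1\le m<n}L(n,m)$. -}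

module Defs where

open import Data.Nat using (ℕ; zero; suc; _+_; _*_; _∸_; _≤_; _⊔_; _≡ᵇ_)
open import Data.Fin using (Fin; toℕ)
open import Data.Bool using (Bool; true; false; _∧_)
open import Data.List using (List; []; _∷_; map; concatMap; length; filterᵇ; foldr; allFin; upTo)
open import Data.Vec using (Vec; []; _∷_)
import Data.Vec as V
open import Data.Product using (Σ; ∃; _×_; _,_)
open import Relation.Nullary using (¬_)
open import Relation.Binary.PropositionalEquality using (_≡_)

record NBW (σ : ℕ) : Set where
  field
    states : ℕ
    initial : Fin states → Bool
    trans : Fin states → Fin σ → Fin states → Bool
    accepting : Fin states → Bool

open NBW public

Word : ℕ → Set
Word σ = ℕ → Fin σ

AcceptingRun : ∀ {σ} (A : NBW σ) → Word σ → (ℕ → Fin (states A)) → Set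
AcceptingRun A α ρ =
  (initial A (ρ 0) ≡ true)
  × (∀ i → trans A (ρ i) (α i) (ρ (suc i)) ≡ true)
  × (∀ i → ∃ λ j → i ≤ j × accepting A (ρ j) ≡ true)

Accepts : ∀ {σ} (A : NBW σ) → Word σ → Set
Accepts A α = ∃ λ (ρ : ℕ → Fin (states A)) → AcceptingRun A α ρ

Complements : ∀ {σ} (B A : NBW σ) → Set
Complements B A = ∀ α → (Accepts B α → ¬ Accepts A α) × (¬ Accepts A α → Accepts B α)

-- C_NBW(A) ≥ k : every NBW over the same alphabet accepting the
-- complement of L(A) has at least k states.
ComplementLowerBound : ∀ {σ} → ℕ → NBW σ → Set
ComplementLowerBound {σ} k A = ∀ (B : NBW σ) → Complements B A → k ≤ states B

-- Q(m)-rankings and L(n,m), L(n).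
-- S'_n is represented by Fin (n ∸ 1); a function h : S'_n → {0,…,2m-1}
-- is represented by a vector Vec (Fin (2*m)) (n ∸ 1).

allVecs : (r k : ℕ) → List (Vec (Fin r) k)
allVecs r zero = [] ∷ []
allVecs r (suc k) = concatMap (λ x → map (x ∷_) (allVecs r k)) (allFin r)

anyL : ∀ {A : Set} → (A → Bool) → List A → Bool
anyL p = foldr (λ x b → p x Data.Bool.∨ b) false

allL : ∀ {A : Set} → (A → Bool) → List A → Bool
allL p = foldr (λ x b → p x ∧ b) true

isQRanking : ∀ {k} (m : ℕ) → Vec (Fin (2 * m)) k → Bool
isQRanking m h =
  allL (λ j → anyL (λ x → toℕ x ≡ᵇ (2 * j + 1)) (V.toList h)) (upTo m)

Lnm : ℕ → ℕ → ℕ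
Lnm n m = length (filterᵇ (isQRanking m) (allVecs (2 * m) (n ∸ 1)))

Ln : ℕ → ℕ
Ln n = foldr _⊔_ 0 (map (λ i → Lnm n (suc i)) (upTo (n ∸ 1)))

{-# OPTIONS --safe #-}

-- Let S' be the states suc s of 𝓑 and s_f = zero the only accepting one.
-- For Q(m)-rankings f and g there is a word w all of whose paths from s to t
-- satisfy g t ≤ f s, strictly if the path visits s_f, and which conversely
-- has a path from s to t, visiting s_f, whenever g t < f s.  Such words compose
-- because every odd rank is attained and can be used as a stepping stone.
--
-- Concatenating such words along a sequence in which every Q(m)-ranking
-- recurs gives a word rejected by 𝓑, since ranks cannot decrease forever.
-- If a complement automaton B had fewer than L(n,m) states, then its run on
-- this word, observed at the rankings in descending lexicographic order, would
-- close a loop with an accepting state from a ranking f to a ranking g with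
-- g s < f s for some s.  Repeating that segment yields a word accepted by B;
-- it is also accepted by 𝓑, by looping from s to s through s_f.
module Submission where

open import Defs
open import Data.Bool using (Bool; true; false; _∨_; _∧_; not; T)
open import Data.Bool.Properties using (∨-assoc; ∨-zeroʳ; ∨-identityʳ; ∧-conicalˡ; ∧-conicalʳ; T-∧; T-∨)
open import Data.Fin using (Fin; zero; suc; toℕ; lift; _≟_)
import Data.Fin as Fin
open import Data.Fin.Properties using (pigeonhole; toℕ<n; toℕ-fromℕ<; toℕ-injective)
open import Data.List using (List; []; _∷_; _++_; replicate; allFin; upTo; cartesianProduct; length; lookup)
open import Data.List.Membership.Propositional using (_∈_)
open import Data.List.Membership.Propositional.Properties using (∈-allFin; ∈-cartesianProduct⁺; ∈-lookup; ∈-upTo⁺)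
open import Data.List.NonEmpty using (List⁺; _∷_; toList; _⁺++⁺_) renaming (length to length⁺)
open import Data.List.Properties using (foldr-preservesᵇ)
open import Data.List.Relation.Unary.All using (All; []; _∷_)
import Data.List.Relation.Unary.All as All
import Data.List.Relation.Unary.All.Properties as Allₚ
open import Data.List.Relation.Unary.AllPairs using (AllPairs; []; _∷_)
import Data.List.Relation.Unary.AllPairs as AllPairs
import Data.List.Relation.Unary.AllPairs.Properties as AllPairsₚ
open import Data.List.Relation.Unary.Any using (Any; here; there)
open import Data.Nat using (ℕ; zero; suc; _+_; _*_; _∸_; _≤_; _<_; z≤n; s≤s; s≤s⁻¹; _<′_; ≤′-reflexive; ≤′-step)
import Data.Nat as ℕ
open import Data.Nat.DivMod using (_%_; _/_; _mod_; m%n<n; n%n≡0; m%n%n≡m%n; %-distribˡ-+; [m+n]%n≡m%n; [m+kn]%n≡m%n; m<n⇒m%n≡m; m≡m%n+[m/n]*n)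
open import Data.Nat.Properties hiding (_≟_)
open import Data.Product using (Σ; ∃; ∃-syntax; _×_; _,_; proj₁; proj₂)
open import Data.Sum using (_⊎_; inj₁; inj₂)
open import Data.Vec using (Vec)
import Data.Vec as Vec
open import Data.Vec.Functional using (updateAt)
open import Data.Vec.Functional.Properties using (updateAt-updates; updateAt-minimal)
open import Data.Vec.Relation.Unary.Any using (index)
open import Data.Vec.Relation.Unary.Any.Properties using (toList⁻; lookup-index)
open import Function using (_∘_; id; const)
open import Function.Bundles using (Equivalence)
open import Relation.Binary.Definitions using (tri<; tri≈; tri>)
open import Relation.Binary.PropositionalEquality renaming (trans to ≡-trans)
open import Relation.Nullary using (¬_; Dec; yes; no; does; contradiction)
open import Relation.Nullary.Decidable using (dec-true; dec-false)

-- Paths, and acceptance of concatenations of nonempty blocks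

-- The Boolean records whether an accepting state occurs on the path; the
-- last state is not counted, so that the flags of consecutive paths are
-- joined by _∨_.
data Path {σ} (A : NBW σ) : List (Fin σ) → Bool → Fin (states A) → Fin (states A) → Set where
  []  : ∀ {s} → Path A [] false s s
  _∷_ : ∀ {a w b s t u} → trans A s a t ≡ true → Path A w b t u →
        Path A (a ∷ w) (accepting A s ∨ b) s u

module _ {σ} {A : NBW σ} where

  infixr 5 _++ᴾ_

  _++ᴾ_ : ∀ {w w′ b b′ s t u} → Path A w b s t → Path A w′ b′ t u → Path A (w ++ w′) (b ∨ b′) s u
  []      ++ᴾ q = q
  _++ᴾ_ {b′ = b′} (_∷_ {b = b} {s = s} e p) q =
    subst (λ c → Path A _ c _ _) (sym (∨-assoc (accepting A s) b b′)) (e ∷ (p ++ᴾ q))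

  splitᴾ : ∀ w {w′ b s u} → Path A (w ++ w′) b s u →
           ∃[ t ] ∃[ b₁ ] ∃[ b₂ ] b ≡ b₁ ∨ b₂ × Path A w b₁ s t × Path A w′ b₂ t u
  splitᴾ []      p = _ , _ , _ , refl , [] , p
  splitᴾ (a ∷ w) (_∷_ {s = s} e p) with splitᴾ w p
  ... | _ , b₁ , b₂ , refl , p₁ , p₂ =
    _ , _ , _ , sym (∨-assoc (accepting A s) b₁ b₂) , e ∷ p₁ , p₂

  castᴾ : ∀ {w b c s t} → b ≡ c → Path A w b s t → Path A w c s t
  castᴾ eq = subst (λ c → Path A _ c _ _) eq

∨≡true : ∀ {x y} → x ∨ y ≡ true → x ≡ true ⊎ y ≡ true
∨≡true {true}  _  = inj₁ refl
∨≡true {false} eq = inj₂ eq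

InfinitelyOften : (ℕ → Set) → Set
InfinitelyOften P = ∀ i → ∃[ j ] i ≤ j × P j

module _ {σ : ℕ} where

  -- The block being read is kept apart from the blocks to come, so that the recursion is on the
  -- position alone.
  flatten : List⁺ (Fin σ) → (ℕ → List⁺ (Fin σ)) → Word σ
  flatten (a ∷ w)     W zero    = a
  flatten (a ∷ [])    W (suc n) = flatten (W 0) (W ∘ suc) n
  flatten (a ∷ b ∷ w) W (suc n) = flatten (b ∷ w) W n

  concatω : (ℕ → List⁺ (Fin σ)) → Word σ
  concatω W = flatten (W 0) (W ∘ suc)

  concatω-shift : ∀ W n → concatω W (n + length⁺ (W 0)) ≡ concatω (W ∘ suc) n
  concatω-shift W n = go (List⁺.head (W 0)) (List⁺.tail (W 0)) (W ∘ suc)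
    where
    go : ∀ a w W → flatten (a ∷ w) W (n + suc (length w)) ≡ concatω W n
    go a []      W rewrite +-comm n 1 = refl
    go a (b ∷ w) W rewrite +-suc n (suc (length w)) = go b w W

  BlockAccepts : NBW σ → (ℕ → List⁺ (Fin σ)) → Set
  BlockAccepts A W = ∃ λ (q : ℕ → Fin (states A)) → ∃ λ (b : ℕ → Bool) → initial A (q 0) ≡ true
    × (∀ i → Path A (toList (W i)) (b i) (q i) (q (suc i)))
    × InfinitelyOften (λ i → b i ≡ true)

module _ {σ} {A : NBW σ} where

  private
    Blocks : (ℕ → List⁺ (Fin σ)) → (ℕ → Bool) → (ℕ → Fin (states A)) → Set
    Blocks W b q = ∀ i → Path A (toList (W i)) (b i) (q i) (q (suc i))

    trajectory : ∀ {W b q v c s} → Path A (toList v) c s (q 0) → Blocks W b q → ℕ → Fin (states A)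
    trajectory {s = s} p ps zero = s
    trajectory {v = a ∷ []} (e ∷ []) ps (suc n) = trajectory (ps 0) (λ i → ps (suc i)) n
    trajectory {v = a ∷ a′ ∷ w} (e ∷ p) ps (suc n) = trajectory {v = a′ ∷ w} p ps n

    trajectory-trans : ∀ {W b q v c s} (p : Path A (toList v) c s (q 0)) (ps : Blocks W b q) n →
      trans A (trajectory p ps n) (flatten v W n) (trajectory p ps (suc n)) ≡ true
    trajectory-trans {v = a ∷ []}     (e ∷ []) ps zero = e
    trajectory-trans {v = a ∷ a′ ∷ w} (e ∷ p)  ps zero = e
    trajectory-trans {v = a ∷ []}     (e ∷ []) ps (suc n) = trajectory-trans (ps 0) (λ i → ps (suc i)) n
    trajectory-trans {v = a ∷ a′ ∷ w} (e ∷ p)  ps (suc n) = trajectory-trans {v = a′ ∷ w} p ps n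

    trajectory-visit : ∀ {W b q v c s} (p : Path A (toList v) c s (q 0)) (ps : Blocks W b q) →
      c ≡ true → ∃[ n ] accepting A (trajectory p ps n) ≡ true
    trajectory-visit {v = a ∷ w} (e ∷ p) ps c≡true with ∨≡true c≡true
    ... | inj₁ acc = 0 , acc
    trajectory-visit {v = a ∷ []} (e ∷ []) ps _ | inj₂ ()
    trajectory-visit {v = a ∷ a′ ∷ w} (e ∷ p) ps _ | inj₂ later
      with trajectory-visit {v = a′ ∷ w} p ps later
    ... | n , acc = suc n , acc

    -- Blocks are nonempty, so prefixing the current one delays every later position by at least
    -- one. Iterated, this places a visit in block `j` at a position no smaller than `j`.
    trajectory-next : ∀ {W b q v c s} (p : Path A (toList v) c s (q 0)) (ps : Blocks W b q) k →
      (∃[ n ] k ≤ n × accepting A (trajectory (ps 0) (λ i → ps (suc i)) n) ≡ true) →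
      ∃[ n ] suc k ≤ n × accepting A (trajectory p ps n) ≡ true
    trajectory-next {v = a ∷ []} (e ∷ []) ps k (n , k≤n , h) = suc n , s≤s k≤n , h
    trajectory-next {v = a ∷ a′ ∷ w} (e ∷ p) ps k h with trajectory-next {v = a′ ∷ w} p ps k h
    ... | n , k<n , h′ = suc n , m≤n⇒m≤1+n k<n , h′

    trajectory-visits : ∀ {W b q v c s} (p : Path A (toList v) c s (q 0)) (ps : Blocks W b q) j →
      b j ≡ true → ∃[ n ] j ≤ n × accepting A (trajectory p ps n) ≡ true
    trajectory-visits p ps zero h with trajectory-visit (ps 0) (λ i → ps (suc i)) h
    ... | n , acc with trajectory-next p ps 0 (n , z≤n , acc)
    ...   | n′ , _ , acc′ = n′ , z≤n , acc′
    trajectory-visits p ps (suc j) h =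
      trajectory-next p ps j (trajectory-visits (ps 0) (λ i → ps (suc i)) j h)

  BlockAccepts⇒Accepts : ∀ {W} → BlockAccepts A W → Accepts A (concatω W)
  BlockAccepts⇒Accepts {W} (q , b , init , ps , inf) =
    -- Block 0 is the one being read, and `trajectory-visits` numbers the blocks after it; hence a
    -- visit is requested in a block of index at least `suc i`.
    trajectory (ps 0) ps′ , init , trajectory-trans (ps 0) ps′ , λ i → visits i (inf (suc i))
    where
    ps′ : Blocks (W ∘ suc) (b ∘ suc) (q ∘ suc)
    ps′ i = ps (suc i)

    visits : ∀ i → ∃[ j ] suc i ≤ j × b j ≡ true →
             ∃[ n ] i ≤ n × accepting A (trajectory (ps 0) ps′ n) ≡ true
    visits i (suc j , s≤s i≤j , bj) with trajectory-visits (ps 0) ps′ j bj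
    ... | n , j≤n , acc = n , ≤-trans i≤j j≤n , acc

  private
    read : ∀ a w {W} {ρ : ℕ → Fin (states A)} →
      (∀ n → trans A (ρ n) (flatten (a ∷ w) W n) (ρ (suc n)) ≡ true) →
      ∃[ b ] Path A (a ∷ w) b (ρ 0) (ρ (suc (length w)))
        × (∀ j → j < suc (length w) → accepting A (ρ j) ≡ true → b ≡ true)
    read a [] {ρ = ρ} step = _ , step 0 ∷ [] , λ where
      zero    _ acc → cong (_∨ false) acc
      (suc j) (s≤s ()) _
    read a (a′ ∷ w) {W} {ρ} step with read a′ w {W} {λ n → ρ (suc n)} (λ n → step (suc n))
    ... | b , p , visit = _ , step 0 ∷ p , λ where
      zero    _         acc → cong (_∨ b) acc
      (suc j) (s≤s j<l) acc → ≡-trans (cong (accepting A (ρ 0) ∨_) (visit j j<l acc)) (∨-zeroʳ _)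

    read⁺ : ∀ v {W} {ρ : ℕ → Fin (states A)} →
      (∀ n → trans A (ρ n) (flatten v W n) (ρ (suc n)) ≡ true) →
      ∃[ b ] Path A (toList v) b (ρ 0) (ρ (length⁺ v))
        × (∀ j → j < length⁺ v → accepting A (ρ j) ≡ true → b ≡ true)
    read⁺ (a ∷ w) {W} {ρ} = read a w {W} {ρ}

    module _ (W : ℕ → List⁺ (Fin σ)) (ρ : ℕ → Fin (states A)) where
      Steps : Set
      Steps = ∀ n → trans A (ρ n) (concatω W n) (ρ (suc n)) ≡ true
      Visits : Set
      Visits = InfinitelyOften λ n → accepting A (ρ n) ≡ true

    tail : List⁺ (Fin σ) → (ℕ → Fin (states A)) → ℕ → Fin (states A)
    tail v ρ n = ρ (n + length⁺ v)

    tail-steps : ∀ W ρ → Steps W ρ → Steps (W ∘ suc) (tail (W 0) ρ)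
    tail-steps W ρ step n =
      subst (λ a → trans A (ρ (n + length⁺ (W 0))) a (ρ (suc n + length⁺ (W 0))) ≡ true) (concatω-shift W n) (step (n + length⁺ (W 0)))

    tail-visits : ∀ W ρ → Visits W ρ → Visits (W ∘ suc) (tail (W 0) ρ)
    tail-visits W ρ visits i with visits (i + length⁺ (W 0))
    ... | j , i+l≤j , acc = j ∸ l , m+n≤o⇒m≤o∸n i i+l≤j
                          , subst (λ n → accepting A (ρ n) ≡ true) (sym (m∸n+n≡m (m+n≤o⇒n≤o i i+l≤j))) acc
      where l = length⁺ (W 0)

    starts : (W : ℕ → List⁺ (Fin σ)) (ρ : ℕ → Fin (states A)) → ℕ → Fin (states A)
    starts W ρ zero    = ρ 0
    starts W ρ (suc i) = starts (W ∘ suc) (tail (W 0) ρ) i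

    flags : ∀ W ρ → Steps W ρ → ℕ → Bool
    flags W ρ step zero    = proj₁ (read⁺ (W 0) {W ∘ suc} {ρ} step)
    flags W ρ step (suc i) = flags (W ∘ suc) (tail (W 0) ρ) (tail-steps W ρ step) i

    blocks : ∀ W ρ (step : Steps W ρ) → Blocks W (flags W ρ step) (starts W ρ)
    blocks W ρ step zero    = proj₁ (proj₂ (read⁺ (W 0) {W ∘ suc} {ρ} step))
    blocks W ρ step (suc i) = blocks (W ∘ suc) (tail (W 0) ρ) (tail-steps W ρ step) i

    -- The bound `m` carries the recursion: skipping a nonempty block brings the visit closer by at
    -- least one position.
    block-of-visit : ∀ W ρ (step : Steps W ρ) n m → n ≤ m → accepting A (ρ n) ≡ true →
                     ∃[ i ] flags W ρ step i ≡ true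
    block-of-visit W ρ step n m n≤m acc with n <? length⁺ (W 0)
    ... | yes n<l = 0 , proj₂ (proj₂ (read⁺ (W 0) {W ∘ suc} {ρ} step)) n n<l acc
    block-of-visit W ρ step zero m n≤m acc | no n≮l with () ← n≮l (s≤s z≤n)
    block-of-visit W ρ step (suc n) (suc m) (s≤s n≤m) acc | no n≮l
      with block-of-visit (W ∘ suc) (tail (W 0) ρ) (tail-steps W ρ step) (suc n ∸ length⁺ (W 0)) m
             (≤-trans (m∸n≤m n (length (List⁺.tail (W 0)))) n≤m)
             (subst (λ n → accepting A (ρ n) ≡ true) (sym (m∸n+n≡m (≮⇒≥ n≮l))) acc)
    ... | i , h = suc i , h

    flags-visits : ∀ W ρ (step : Steps W ρ) → Visits W ρ → InfinitelyOften λ i → flags W ρ step i ≡ true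
    flags-visits W ρ step visits zero with visits 0
    ... | n , _ , acc with block-of-visit W ρ step n n ≤-refl acc
    ...   | i , h = i , z≤n , h
    flags-visits W ρ step visits (suc i)
      with flags-visits (W ∘ suc) (tail (W 0) ρ) (tail-steps W ρ step) (tail-visits W ρ visits) i
    ... | j , i≤j , h = suc j , s≤s i≤j , h

  Accepts⇒BlockAccepts : ∀ {W} → Accepts A (concatω W) → BlockAccepts A W
  Accepts⇒BlockAccepts {W} (ρ , init , step , visits) =
    starts W ρ , flags W ρ step , init , blocks W ρ step , flags-visits W ρ step visits

-- The automaton and the words for elementary changes of rankings

does⇒ : ∀ {P : Set} (P? : Dec P) → does P? ≡ true → P
does⇒ (yes p) _ = p

iter : ∀ {A : Set} → (A → A) → ℕ → A → A
iter f zero    x = x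
iter f (suc k) x = iter f k (f x)

rotate : ∀ {n} → Fin n → Fin n
rotate {suc n} i = suc (toℕ i) mod suc n

toℕ-iter-rotate : ∀ {n} k (i : Fin (suc n)) → toℕ (iter rotate k i) ≡ (toℕ i + k) % suc n
toℕ-iter-rotate zero i rewrite +-identityʳ (toℕ i) = sym (m<n⇒m%n≡m (toℕ<n i))
toℕ-iter-rotate {n} (suc k) i = begin
  toℕ (iter rotate k (rotate i))                     ≡⟨ toℕ-iter-rotate k (rotate i) ⟩
  (toℕ (rotate i) + k) % suc n                       ≡⟨ cong (λ x → (x + k) % suc n) (toℕ-fromℕ< (m%n<n (suc (toℕ i)) (suc n))) ⟩
  (suc (toℕ i) % suc n + k) % suc n                  ≡⟨ %-distribˡ-+ (suc (toℕ i) % suc n) k (suc n) ⟩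
  (suc (toℕ i) % suc n % suc n + k % suc n) % suc n  ≡⟨ cong (λ x → (x + k % suc n) % suc n) (m%n%n≡m%n (suc (toℕ i)) (suc n)) ⟩
  (suc (toℕ i) % suc n + k % suc n) % suc n          ≡⟨ %-distribˡ-+ (suc (toℕ i)) k (suc n) ⟨
  (suc (toℕ i) + k) % suc n                          ≡⟨ cong (_% suc n) (+-suc (toℕ i) k) ⟨
  (toℕ i + suc k) % suc n                            ∎
  where open ≡-Reasoning

iter-+ : ∀ {A : Set} (f : A → A) k l x → iter f l (iter f k x) ≡ iter f (k + l) x
iter-+ f zero    l x = refl
iter-+ f (suc k) l x = iter-+ f k l (f x)

iter-rotate-period : ∀ {n} k l (i : Fin (suc n)) → k + l ≡ suc n → iter rotate l (iter rotate k i) ≡ i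
iter-rotate-period {n} k l i k+l≡n = toℕ-injective (begin
  toℕ (iter rotate l (iter rotate k i))  ≡⟨ cong toℕ (iter-+ rotate k l i) ⟩
  toℕ (iter rotate (k + l) i)            ≡⟨ toℕ-iter-rotate (k + l) i ⟩
  (toℕ i + (k + l)) % suc n              ≡⟨ cong (λ x → (toℕ i + x) % suc n) k+l≡n ⟩
  (toℕ i + suc n) % suc n                ≡⟨ [m+n]%n≡m%n (toℕ i) (suc n) ⟩
  toℕ i % suc n                          ≡⟨ m<n⇒m%n≡m (toℕ<n i) ⟩
  toℕ i                                  ∎)
  where open ≡-Reasoning

-- A word can only apply positive powers of a letter, so the inverse of `k` rotations is given as
-- `l` further rotations; it exists because `rotate` has finite order.
rotate-to-front : ∀ {n} (i : Fin n) → ∃[ k ] ∃[ l ] toℕ (iter rotate k i) ≡ 0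
  × (∀ j → iter (rotate {n}) l (iter rotate k j) ≡ j) × (∀ j → iter (rotate {n}) k (iter rotate l j) ≡ j)
rotate-to-front {suc n} i = suc n ∸ toℕ i , toℕ i , front
  , (λ j → iter-rotate-period {n} (suc n ∸ toℕ i) (toℕ i) j (m∸n+n≡m (<⇒≤ (toℕ<n i))))
  , (λ j → iter-rotate-period {n} (toℕ i) (suc n ∸ toℕ i) j (m+[n∸m]≡n (<⇒≤ (toℕ<n i))))
  where
  open ≡-Reasoning
  front = begin
    toℕ (iter rotate (suc n ∸ toℕ i) i)    ≡⟨ toℕ-iter-rotate (suc n ∸ toℕ i) i ⟩
    (toℕ i + (suc n ∸ toℕ i)) % suc n      ≡⟨ cong (_% suc n) (m+[n∸m]≡n (<⇒≤ (toℕ<n i))) ⟩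
    suc n % suc n                          ≡⟨ n%n≡0 (suc n) ⟩
    0                                      ∎

iter-lift : ∀ {n} (f : Fin n → Fin n) k i → iter (lift 1 f) k (suc i) ≡ suc (iter f k i)
iter-lift f zero    i = refl
iter-lift f (suc k) i = iter-lift f k (f i)

iter-lift-zero : ∀ {n} (f : Fin n → Fin n) k → iter (lift 1 f) k zero ≡ zero
iter-lift-zero f zero    = refl
iter-lift-zero f (suc k) = iter-lift-zero f k

iter-lift-inverse : ∀ {n} (f : Fin n → Fin n) k l → (∀ i → iter f l (iter f k i) ≡ i) →
                    ∀ i → iter (lift 1 f) l (iter (lift 1 f) k i) ≡ i
iter-lift-inverse f k l h zero
  rewrite iter-lift-zero f k = iter-lift-zero f l
iter-lift-inverse f k l h (suc i)
  rewrite iter-lift f k i | iter-lift f l (iter f k i) = cong suc (h i)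

swap₀₁ : ∀ {n} → Fin n → Fin n
swap₀₁ {suc (suc n)} zero       = suc zero
swap₀₁ {suc (suc n)} (suc zero) = zero
swap₀₁ i = i

swap₀₁-involutive : ∀ {n} (i : Fin n) → swap₀₁ (swap₀₁ i) ≡ i
swap₀₁-involutive {suc zero}    zero          = refl
swap₀₁-involutive {suc (suc n)} zero          = refl
swap₀₁-involutive {suc (suc n)} (suc zero)    = refl
swap₀₁-involutive {suc (suc n)} (suc (suc i)) = refl

swap₀₁-zero : ∀ {n} {i : Fin (suc n)} → toℕ i ≡ 1 → swap₀₁ zero ≡ i
swap₀₁-zero {suc n} {suc zero} refl = refl

swap₀₁-other : ∀ {n} {i : Fin (suc n)} → i ≢ zero → toℕ i ≢ 1 → swap₀₁ i ≡ i
swap₀₁-other {n}     {zero}        i≢0 _ = contradiction refl i≢0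
swap₀₁-other {suc n} {suc zero}    _ i≢1 = contradiction refl i≢1
swap₀₁-other {suc n} {suc (suc i)} _ _   = refl

pattern rotateₗ  = zero
pattern rotate′ₗ = suc zero
pattern swapₗ    = suc (suc zero)
pattern addₗ     = suc (suc (suc zero))
pattern enterₗ   = suc (suc (suc (suc zero)))
pattern exitₗ    = suc (suc (suc (suc (suc zero))))
pattern killₗ    = suc (suc (suc (suc (suc (suc zero)))))

-- The last four letters single out only the first two states of `S'`; the three permutation letters
-- carry them over to any states, which keeps the alphabet at seven letters for every `k`. The
-- second state is described by `toℕ t` being 1 because `S'` may have just one element.
edge : ∀ {k} → Fin (suc (suc k)) → Fin 7 → Fin (suc (suc k)) → Bool
edge zero    exitₗ    (suc t) = does (toℕ t ℕ.≟ 1)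
edge zero    _        _       = false
edge (suc s) enterₗ   zero    = does (s ≟ zero)
edge (suc s) _        zero    = false
edge (suc s) rotateₗ  (suc t) = does (rotate s ≟ t)
edge (suc s) rotate′ₗ (suc t) = does (lift 1 rotate s ≟ t)
edge (suc s) swapₗ    (suc t) = does (swap₀₁ s ≟ t)
edge (suc s) addₗ     (suc t) = does (s ≟ t) ∨ (does (s ≟ zero) ∧ does (toℕ t ℕ.≟ 1))
edge (suc s) enterₗ   (suc t) = does (s ≟ t)
edge (suc s) exitₗ    (suc t) = does (s ≟ t)
edge (suc s) killₗ    (suc t) = does (s ≟ t) ∧ not (does (s ≟ zero))

isZero : ∀ {n} → Fin n → Bool
isZero zero    = true
isZero (suc _) = false

-- The state zero is the paper's s_f; the states suc s form S'.
𝓑 : ℕ → NBW 7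
𝓑 k = record
  { states    = suc (suc k)
  ; initial   = not ∘ isZero
  ; trans     = edge
  ; accepting = isZero
  }

-- Words along which ranks descend, and conjugation by permutations

module _ {k : ℕ} where

  Ranking : Set
  Ranking = Fin (suc k) → ℕ

  _⟨_⟩⟶_ : Fin (suc k) → List (Fin 7) × Bool → Fin (suc k) → Set
  s ⟨ w , b ⟩⟶ t = Path (𝓑 k) w b (suc s) (suc t)

  -- The rank of the accepting state is a parameter because inside a word that passes through this
  -- state it must lie between the ranks of the two ends.
  extend : ℕ → Ranking → Fin (suc (suc k)) → ℕ
  extend c f zero    = c
  extend c f (suc s) = f s

  Sound : (Fin (suc (suc k)) → ℕ) → List (Fin 7) → (Fin (suc (suc k)) → ℕ) → Set
  Sound F w G = ∀ {b s t} → Path (𝓑 k) w b s t → G t ≤ F s × (b ≡ true → G t < F s)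

  -- With rank 0 for the accepting state, no path on a nonempty word can start there: its flag would
  -- be true and it would have to end below 0.
  Descends : Ranking → List (Fin 7) → Ranking → Set
  Descends f w g = Sound (extend 0 f) w (extend 0 g)

  sound-letter : ∀ F G a →
    (∀ s t → edge (suc s) a t ≡ true → G t ≤ F (suc s)) →
    (∀ t → edge zero a t ≡ true → G t < F zero) → Sound F (a ∷ []) G
  sound-letter F G a h h₀ {s = zero}  (e ∷ []) = <⇒≤ (h₀ _ e) , λ _ → h₀ _ e
  sound-letter F G a h h₀ {s = suc s} (e ∷ []) = h _ _ e , λ ()

  sound-++ : ∀ {F G H w w′} → Sound F w G → Sound G w′ H → Sound F (w ++ w′) H
  sound-++ {w = w} S S′ p with splitᴾ w p
  ... | _ , b₁ , b₂ , refl , p₁ , p₂ = ≤-trans (proj₁ (S′ p₂)) (proj₁ (S p₁)) , strict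
    where
    strict : b₁ ∨ b₂ ≡ true → _
    strict eq with ∨≡true {b₁} eq
    ... | inj₁ eq₁ = ≤-<-trans (proj₁ (S′ p₂)) (proj₂ (S p₁) eq₁)
    ... | inj₂ eq₂ = <-≤-trans (proj₂ (S′ p₂) eq₂) (proj₁ (S p₁))

  descends-[] : ∀ {f g} → (∀ s → g s ≤ f s) → Descends f [] g
  descends-[] h {s = zero}  [] = z≤n , λ ()
  descends-[] h {s = suc s} [] = h s , λ ()

  descends-≗ : ∀ {f f′ g g′ w} → f ≗ f′ → g ≗ g′ → Descends f w g → Descends f′ w g′
  descends-≗ {f} {f′} {g} {g′} ef eg S {s = s} {t} p = subst₂ (λ x y → y ≤ x × (_ → y < x)) (ext ef s) (ext eg t) (S p)
    where
    ext : ∀ {f g} → f ≗ g → extend 0 f ≗ extend 0 g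
    ext eq zero    = refl
    ext eq (suc s) = eq s

  record Permutes (w : List (Fin 7)) (π : Fin (suc k) → Fin (suc k)) : Set where
    field
      descends : ∀ g → Descends (g ∘ π) w g
      path     : ∀ s → s ⟨ w , false ⟩⟶ π s

  open Permutes

  permutes-letter : ∀ a {π : Fin (suc k) → Fin (suc k)} → (∀ s t → edge (suc s) a (suc t) ≡ does (π s ≟ t)) →
    (∀ t → edge zero a t ≡ false) → Permutes (a ∷ []) π
  permutes-letter a {π} h h₀ .descends g =
    sound-letter (extend 0 (g ∘ π)) (extend 0 g) a down (λ t e → contradiction (≡-trans (sym (h₀ t)) e) λ ())
    where
    down : ∀ s t → edge (suc s) a t ≡ true → extend 0 g t ≤ g (π s)
    down s zero    e = z≤n
    down s (suc t) e = ≤-reflexive (cong g (sym (does⇒ (π s ≟ t) (≡-trans (sym (h s t)) e))))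
  permutes-letter a {π} h h₀ .path s = ≡-trans (h s (π s)) (dec-true (π s ≟ π s) refl) ∷ []

  permutes-[] : Permutes [] id
  permutes-[] .descends g = descends-[] (λ s → ≤-refl)
  permutes-[] .path s     = []

  permutes-++ : ∀ {w w′ π π′} → Permutes w π → Permutes w′ π′ → Permutes (w ++ w′) (π′ ∘ π)
  permutes-++ {π′ = π′} P P′ .descends g = sound-++ (P .descends (g ∘ π′)) (P′ .descends g)
  permutes-++ {π = π}   P P′ .path s     = P .path s ++ᴾ P′ .path (π s)

  permutes-iter : ∀ {a π} → Permutes (a ∷ []) π → ∀ l → Permutes (replicate l a) (iter π l)
  permutes-iter P zero    = permutes-[]
  permutes-iter P (suc l) = permutes-++ P (permutes-iter P l)

  rotate-permutes : Permutes (rotateₗ ∷ []) rotate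
  rotate-permutes = permutes-letter rotateₗ (λ _ _ → refl) λ where
    zero → refl
    (suc _) → refl

  rotate′-permutes : Permutes (rotate′ₗ ∷ []) (lift 1 rotate)
  rotate′-permutes = permutes-letter rotate′ₗ (λ _ _ → refl) λ where
    zero → refl
    (suc _) → refl

  swap-permutes : Permutes (swapₗ ∷ []) swap₀₁
  swap-permutes = permutes-letter swapₗ (λ _ _ → refl) λ where
    zero → refl
    (suc _) → refl

  -- Conjugating by a shuffle lets a letter that acts on the first two states
  -- of S' act on any two of them.
  record Shuffle : Set where
    field
      {to from}     : List (Fin 7)
      {π π⁻¹}       : Fin (suc k) → Fin (suc k)
      to-permutes   : Permutes to π
      from-permutes : Permutes from π⁻¹
      inverseˡ      : ∀ s → π⁻¹ (π s) ≡ s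
      inverseʳ      : ∀ s → π (π⁻¹ s) ≡ s

    π-injective : ∀ {s t} → π s ≡ π t → s ≡ t
    π-injective eq = ≡-trans (sym (inverseˡ _)) (≡-trans (cong π⁻¹ eq) (inverseˡ _))

    conjugate : List (Fin 7) → List (Fin 7)
    conjugate u = to ++ u ++ from

    conjugate-descends : ∀ {f g u} → Descends (f ∘ π⁻¹) u (g ∘ π⁻¹) → Descends f (conjugate u) g
    conjugate-descends {f} {g} S = sound-++
      (descends-≗ (λ s → cong f (inverseˡ s)) (λ _ → refl) (to-permutes .descends (f ∘ π⁻¹)))
      (sound-++ S (descends-≗ (λ _ → refl) (λ _ → refl) (from-permutes .descends g)))

    conjugate-path : ∀ {u b s t} → π s ⟨ u , b ⟩⟶ t → s ⟨ conjugate u , b ⟩⟶ π⁻¹ t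
    conjugate-path {b = b} {s} {t} p =
      castᴾ (∨-identityʳ b) (to-permutes .path s ++ᴾ p ++ᴾ from-permutes .path t)

    conjugate-path′ : ∀ {u b s t} → π s ⟨ u , b ⟩⟶ π t → s ⟨ conjugate u , b ⟩⟶ t
    conjugate-path′ p = subst (λ t → Path _ _ _ _ (suc t)) (inverseˡ _) (conjugate-path p)

  open Shuffle

  _⊙_ : Shuffle → Shuffle → Shuffle
  (C ⊙ D) .to            = C .to ++ D .to
  (C ⊙ D) .from          = D .from ++ C .from
  (C ⊙ D) .π             = D .π ∘ C .π
  (C ⊙ D) .π⁻¹           = C .π⁻¹ ∘ D .π⁻¹
  (C ⊙ D) .to-permutes   = permutes-++ (C .to-permutes) (D .to-permutes)
  (C ⊙ D) .from-permutes = permutes-++ (D .from-permutes) (C .from-permutes)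
  (C ⊙ D) .inverseˡ s    = ≡-trans (cong (C .π⁻¹) (D .inverseˡ (C .π s))) (C .inverseˡ s)
  (C ⊙ D) .inverseʳ s    = ≡-trans (cong (D .π) (C .inverseʳ (D .π⁻¹ s))) (D .inverseʳ s)

  to-front : ∀ x → ∃[ C ] C .π x ≡ zero
  to-front x with rotate-to-front x
  ... | l , l′ , front , invˡ , invʳ = record
    { to-permutes   = permutes-iter rotate-permutes l
    ; from-permutes = permutes-iter rotate-permutes l′
    ; inverseˡ      = invˡ
    ; inverseʳ      = invʳ
    } , toℕ-injective front

  to-second : ∀ y → y ≢ zero → ∃[ C ] C .π zero ≡ zero × toℕ (C .π y) ≡ 1
  to-second zero    y≢0 = contradiction refl y≢0
  to-second (suc y) _   with rotate-to-front y
  ... | l , l′ , front , invˡ , invʳ = record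
    { to-permutes   = permutes-iter rotate′-permutes l
    ; from-permutes = permutes-iter rotate′-permutes l′
    ; inverseˡ      = iter-lift-inverse rotate l l′ invˡ
    ; inverseʳ      = iter-lift-inverse rotate l′ l invʳ
    }
    , iter-lift-zero rotate l , ≡-trans (cong toℕ (iter-lift rotate l y)) (cong suc front)

  -- First rotate all of `S'` to bring `x` to the front, then rotate the rest, which leaves the
  -- front fixed, to bring `y` next to it.
  to-front-pair : ∀ {x y} → x ≢ y → ∃[ C ] C .π x ≡ zero × toℕ (C .π y) ≡ 1
  to-front-pair {x} {y} x≢y with to-front x
  ... | C , Cx≡0 with to-second (C .π y) (λ Cy≡0 → x≢y (π-injective C (≡-trans Cx≡0 (sym Cy≡0))))
  ...   | D , D0≡0 , Dy≡1 = C ⊙ D , ≡-trans (cong (D .π) Cx≡0) D0≡0 , Dy≡1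

  -- Words that add an edge, visit the accepting state, kill a state or exchange two states

  Keeps : List (Fin 7) → Set
  Keeps w = ∀ s → s ⟨ w , false ⟩⟶ s

  keeps-++ : ∀ {w w′} → Keeps w → Keeps w′ → Keeps (w ++ w′)
  keeps-++ K K′ s = K s ++ᴾ K′ s

  self : ∀ (s : Fin (suc k)) → does (s ≟ s) ≡ true
  self s = dec-true (s ≟ s) refl

  front-add-descends : ∀ {f} → (∀ y → toℕ y ≡ 1 → f y ≤ f zero) → Descends f (addₗ ∷ []) f
  front-add-descends {f} h = sound-letter (extend 0 f) (extend 0 f) addₗ down λ where
      zero    ()
      (suc _) ()
    where
    down : ∀ s t → edge (suc s) addₗ t ≡ true → extend 0 f t ≤ f s
    down s zero e = z≤n
    down s (suc t) e with ∨≡true e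
    ... | inj₁ s≡t rewrite does⇒ (s ≟ t) s≡t = ≤-refl
    ... | inj₂ e′ rewrite does⇒ (s ≟ zero) (∧-conicalˡ _ _ e′) =
      h t (does⇒ (toℕ t ℕ.≟ 1) (∧-conicalʳ (does (s ≟ zero)) _ e′))

  front-add-keeps : Keeps (addₗ ∷ [])
  front-add-keeps s = cong (_∨ (does (s ≟ zero) ∧ does (toℕ s ℕ.≟ 1))) (self s) ∷ []

  front-add-path : ∀ {x y} → x ≡ zero → toℕ y ≡ 1 → x ⟨ addₗ ∷ [] , false ⟩⟶ y
  front-add-path {y = y} refl y≡1 =
    ≡-trans (cong (does (zero ≟ y) ∨_) (dec-true (toℕ y ℕ.≟ 1) y≡1)) (∨-zeroʳ _) ∷ []

  enter-sound : ∀ {c f} → c ≤ f zero → Sound (extend 0 f) (enterₗ ∷ []) (extend c f)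
  enter-sound {c} {f} c≤f0 = sound-letter (extend 0 f) (extend c f) enterₗ down λ where
      zero    ()
      (suc _) ()
    where
    down : ∀ s t → edge (suc s) enterₗ t ≡ true → extend c f t ≤ f s
    down s zero    e rewrite does⇒ (s ≟ zero) e = c≤f0
    down s (suc t) e rewrite does⇒ (s ≟ t) e    = ≤-refl

  exit-sound : ∀ {c f} → (∀ y → toℕ y ≡ 1 → f y < c) → Sound (extend c f) (exitₗ ∷ []) (extend 0 f)
  exit-sound {c} {f} h = sound-letter (extend c f) (extend 0 f) exitₗ down λ where
      zero    ()
      (suc t) e → h t (does⇒ (toℕ t ℕ.≟ 1) e)
    where
    down : ∀ s t → edge (suc s) exitₗ t ≡ true → extend 0 f t ≤ f s
    down s zero    e = z≤n
    down s (suc t) e rewrite does⇒ (s ≟ t) e = ≤-refl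

  detour : List (Fin 7)
  detour = enterₗ ∷ exitₗ ∷ []

  detour-descends : ∀ {f} → (∀ y → toℕ y ≡ 1 → f y < f zero) → Descends f detour f
  -- Between the two letters the accepting state has the rank of the first state: entering it keeps
  -- the rank and leaving it lowers the rank strictly.
  detour-descends h = sound-++ (enter-sound ≤-refl) (exit-sound h)

  detour-keeps : Keeps detour
  detour-keeps s = self s ∷ self s ∷ []

  detour-path : ∀ {x y} → x ≡ zero → toℕ y ≡ 1 → x ⟨ detour , true ⟩⟶ y
  detour-path {y = y} refl y≡1 = refl ∷ dec-true (toℕ y ℕ.≟ 1) y≡1 ∷ []

  front-kill-descends : ∀ {f g} → (∀ s → s ≢ zero → g s ≤ f s) → Descends f (killₗ ∷ []) g
  front-kill-descends {f} {g} h = sound-letter (extend 0 f) (extend 0 g) killₗ down λ where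
      zero    ()
      (suc _) ()
    where
    down : ∀ s t → edge (suc s) killₗ t ≡ true → extend 0 g t ≤ f s
    down s zero e = z≤n
    down s (suc t) e with s ≟ t | s ≟ zero
    ... | yes refl | no s≢0 = h s s≢0
    down s (suc t) () | yes _ | yes _
    down s (suc t) () | no _  | _

  front-kill-path : ∀ {s} → s ≢ zero → s ⟨ killₗ ∷ [] , false ⟩⟶ s
  front-kill-path {s} s≢0 =
    cong₂ (λ x y → x ∧ not y) (self s) (dec-false (s ≟ zero) s≢0) ∷ []

  add-word : ∀ {f x y} → x ≢ y → f y ≤ f x →
    ∃[ w ] Descends f w f × Keeps w × x ⟨ w , false ⟩⟶ y
  add-word {f} {x} {y} x≢y fy≤fx with to-front-pair x≢y
  ... | C , Cx≡0 , Cy≡1 = conjugate C (addₗ ∷ [])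
    , conjugate-descends C (front-add-descends λ z z≡1 → subst₂ _≤_
        (cong f (≡-trans (sym (C .inverseˡ y)) (cong (C .π⁻¹) (toℕ-injective (≡-trans Cy≡1 (sym z≡1))))))
        (cong f (≡-trans (sym (C .inverseˡ x)) (cong (C .π⁻¹) Cx≡0)))
        fy≤fx)
    , (λ s → conjugate-path′ C (front-add-keeps (C .π s)))
    , conjugate-path′ C (front-add-path Cx≡0 Cy≡1)

  visit-word : ∀ {f x y} → f y < f x →
    ∃[ w ] Descends f w f × Keeps w × x ⟨ w , true ⟩⟶ y
  visit-word {f} {x} {y} fy<fx with to-front-pair {x} {y} (λ { refl → <-irrefl refl fy<fx })
  ... | C , Cx≡0 , Cy≡1 = conjugate C detour
    , conjugate-descends C (detour-descends λ z z≡1 → subst₂ _<_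
        (cong f (≡-trans (sym (C .inverseˡ y)) (cong (C .π⁻¹) (toℕ-injective (≡-trans Cy≡1 (sym z≡1))))))
        (cong f (≡-trans (sym (C .inverseˡ x)) (cong (C .π⁻¹) Cx≡0)))
        fy<fx)
    , (λ s → conjugate-path′ C (detour-keeps (C .π s)))
    , conjugate-path′ C (detour-path Cx≡0 Cy≡1)

  kill-word : ∀ x → ∃[ w ] (∀ {f g} → (∀ s → s ≢ x → g s ≤ f s) → Descends f w g)
    × (∀ {s} → s ≢ x → s ⟨ w , false ⟩⟶ s)
  kill-word x with to-front x
  ... | C , Cx≡0 = conjugate C (killₗ ∷ [])
    , (λ h → conjugate-descends C (front-kill-descends λ s s≢0 → h (C .π⁻¹ s) λ eq →
         s≢0 (≡-trans (sym (C .inverseʳ s)) (≡-trans (cong (C .π) eq) Cx≡0))))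
    , (λ s≢x → conjugate-path′ C (front-kill-path λ Cs≡0 → s≢x (π-injective C (≡-trans Cs≡0 (sym Cx≡0)))))

  record Transposition (x y : Fin (suc k)) : Set where
    field
      {word}     : List (Fin 7)
      τ          : Fin (suc k) → Fin (suc k)
      descends   : ∀ f → Descends f word (f ∘ τ)
      path       : ∀ s → s ⟨ word , false ⟩⟶ τ s
      involutive : ∀ s → τ (τ s) ≡ s
      τ-left     : τ x ≡ y
      τ-other    : ∀ {z} → z ≢ x → z ≢ y → τ z ≡ z

    τ-right : τ y ≡ x
    τ-right = ≡-trans (cong τ (sym τ-left)) (involutive x)

  transposition : ∀ {x y} → x ≢ y → Transposition x y
  transposition {x} {y} x≢y with to-front-pair x≢y
  ... | C , Cx≡0 , Cy≡1 = record
    { τ          = C .π⁻¹ ∘ swap₀₁ ∘ C .π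
    ; descends   = λ f → conjugate-descends C (descends-≗
        (λ s → cong (f ∘ C .π⁻¹) (≡-trans (cong swap₀₁ (C .inverseʳ _)) (swap₀₁-involutive s)))
        (λ _ → refl)
        (swap-permutes .descends (f ∘ C .π⁻¹ ∘ swap₀₁ ∘ C .π ∘ C .π⁻¹)))
    ; path       = λ s → conjugate-path C (swap-permutes .path (C .π s))
    ; involutive = λ s → ≡-trans (cong (C .π⁻¹ ∘ swap₀₁) (C .inverseʳ _))
        (≡-trans (cong (C .π⁻¹) (swap₀₁-involutive _)) (C .inverseˡ s))
    ; τ-left     = ≡-trans (cong (C .π⁻¹ ∘ swap₀₁) Cx≡0)
        (≡-trans (cong (C .π⁻¹) (swap₀₁-zero Cy≡1)) (C .inverseˡ y))
    ; τ-other    = λ z≢x z≢y → ≡-trans (cong (C .π⁻¹) (swap₀₁-other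
        (λ Cz≡0 → z≢x (π-injective C (≡-trans Cz≡0 (sym Cx≡0))))
        (λ Cz≡1 → z≢y (π-injective C (toℕ-injective (≡-trans Cz≡1 (sym Cy≡1)))))))
        (C .inverseˡ _)
    }

-- Composing rankings

module _ {k : ℕ} where

  Reaches : Ranking {k} → List (Fin 7) → Ranking → Fin (suc k) → Fin (suc k) → Set
  Reaches f w g s t = ∃[ b ] s ⟨ w , b ⟩⟶ t × (g t < f s → b ≡ true)

  -- These are the Q(m)-rankings, as functions into the natural numbers.
  record Tight (m : ℕ) (f : Ranking {k}) : Set where
    field
      bounded : ∀ s → f s < 2 * m
      onto    : ∀ j → j < m → ∃[ s ] f s ≡ 2 * j + 1

  open Tight

  -- Paths are promised only across an odd rank lying between the two ends. By `odd-between` this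
  -- covers every strict drop from a rank below `2 * m`; between equal ranks it covers the odd ones.
  -- In this form the property composes.
  record Good (m : ℕ) (f : Ranking {k}) (w : List (Fin 7)) (g : Ranking) : Set where
    field
      descends : Descends f w g
      reaches  : ∀ {s t j} → j < m → g t ≤ 2 * j + 1 → 2 * j + 1 ≤ f s → Reaches f w g s t

  open Good

  -- The middle word need not be good: it suffices that for each odd rank some path crosses it
  -- between two states of that rank. The outer words lead to and from these states.
  good-bridge : ∀ {m f g h i w w′ w″} → Good m f w g →
    Descends g w′ h → (∀ j → j < m → ∃[ u ] ∃[ v ] g u ≡ 2 * j + 1 × h v ≡ 2 * j + 1 × ∃[ b ] u ⟨ w′ , b ⟩⟶ v) →
    Good m h w″ i → Good m f (w ++ w′ ++ w″) i
  good-bridge G D bridge H .descends = sound-++ (G .descends) (sound-++ D (H .descends))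
  good-bridge {f = f} {i = i} G D bridge H .reaches {s} {t} {j} j<m it≤r r≤fs
    with bridge j j<m
  ... | u , v , gu≡r , hv≡r , b′ , p′
    with G .reaches j<m (≤-reflexive gu≡r) r≤fs | H .reaches j<m it≤r (≤-reflexive (sym hv≡r))
  ...   | b , p , strict | b″ , p″ , strict″ = b ∨ b′ ∨ b″ , p ++ᴾ p′ ++ᴾ p″ , flag
    where
    flag : i t < f s → b ∨ b′ ∨ b″ ≡ true
    -- A strict drop overall is strict before or after the stepping stone of rank `2 * j + 1`, and
    -- that part of the path has a true flag.
    flag it<fs with 2 * j + 1 ℕ.<? f s
    ... | yes r<fs = cong (_∨ b′ ∨ b″) (strict (subst (_< f s) (sym gu≡r) r<fs))
    ... | no r≮fs
      rewrite strict″ (subst (i t <_) (sym hv≡r) (<-≤-trans it<fs (≮⇒≥ r≮fs))) | ∨-zeroʳ b′ = ∨-zeroʳ b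

  good-++ : ∀ {m f g h w w′} → Tight m g → Good m f w g → Good m g w′ h → Good m f (w ++ w′) h
  good-++ tight G H = good-bridge G (descends-[] λ _ → ≤-refl)
    (λ j j<m → let u , eq = tight .onto j j<m in u , u , eq , eq , false , []) H

  good-≗ : ∀ {m f g h w} → g ≗ h → Good m f w g → Good m f w h
  good-≗ eq G .descends = descends-≗ (λ _ → refl) eq (G .descends)
  good-≗ {f = f} eq G .reaches {s} {t} {j} j<m ht≤r r≤fs
    with G .reaches {s} {t} {j} j<m (subst (_≤ 2 * j + 1) (sym (eq t)) ht≤r) r≤fs
  ... | b , p , strict = b , p , strict ∘ subst (_< f s) (sym (eq t))

  good-enter : ∀ {m f g w} → Good m f w g → Good m f (enterₗ ∷ w) g
  good-enter G .descends = sound-++ (enter-sound z≤n) (G .descends)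
  good-enter G .reaches {s} j<m gt≤r r≤fs with G .reaches j<m gt≤r r≤fs
  ... | b , p , strict = b , self s ∷ p , strict

  MixesPair : Ranking → List (Fin 7) → Fin (suc k) × Fin (suc k) → Set
  MixesPair f w (x , y) = f y ≤ f x → Reaches f w f x y

  mixes-keeps : ∀ {f w w′ xy} → Keeps w → MixesPair f w′ xy → MixesPair f (w ++ w′) xy
  mixes-keeps K M fy≤fx with M fy≤fx
  ... | b , p , strict = b , K _ ++ᴾ p , strict

  keeps-mixes : ∀ {f w w′ xy} → MixesPair f w xy → Keeps w′ → MixesPair f (w ++ w′) xy
  keeps-mixes M K fy≤fx with M fy≤fx
  ... | b , p , strict = b ∨ false , p ++ᴾ K _ , λ lt → cong (_∨ false) (strict lt)

  mix-pair : ∀ f xy → ∃[ w ] Descends f w f × Keeps w × MixesPair f w xy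
  mix-pair f (x , y) with x ≟ y
  ... | yes refl = [] , descends-[] (λ _ → ≤-refl) , (λ _ → []) ,
                   λ _ → false , [] , λ lt → contradiction lt (<-irrefl refl)
  ... | no x≢y with <-cmp (f y) (f x)
  ...   | tri< fy<fx _ _ = let w , D , K , p = visit-word fy<fx in w , D , K , λ _ → true , p , λ _ → refl
  ...   | tri≈ fy≮fx fy≡fx _ = let w , D , K , p = add-word {f = f} x≢y (≤-reflexive fy≡fx) in
                            w , D , K , λ _ → false , p , λ lt → contradiction lt fy≮fx
  ...   | tri> _ _ fx<fy = [] , descends-[] (λ _ → ≤-refl) , (λ _ → []) ,
                           λ fy≤fx → contradiction fx<fy (≤⇒≯ fy≤fx)

  mix-pairs : ∀ f xys → ∃[ w ] Descends f w f × Keeps w × All (MixesPair f w) xys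
  mix-pairs f [] = [] , descends-[] (λ _ → ≤-refl) , (λ _ → []) , []
  mix-pairs f (xy ∷ xys) with mix-pair f xy | mix-pairs f xys
  ... | w , D , K , M | w′ , D′ , K′ , Ms =
    w ++ w′ , sound-++ D D′ , keeps-++ K K′ ,
    keeps-mixes {f} {xy = xy} M K′ ∷ All.map (λ {xy} → mixes-keeps {f} {xy = xy} K) Ms

  -- The pairs of states are served one after another. Each piece lets every state stay where it is,
  -- so the path made for one pair survives the pieces for the others.
  mix : ∀ m f → ∃[ w ] Good m f w f
  mix m f with mix-pairs f (cartesianProduct (allFin _) (allFin _))
  ... | w , D , _ , Ms = w , record
    { descends = D
    ; reaches  = λ {s} {t} _ ft≤r r≤fs →
        All.lookup Ms (∈-cartesianProduct⁺ (∈-allFin s) (∈-allFin t)) (≤-trans ft≤r r≤fs)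
    }

  -- Transforming one tight ranking into another

  module _ {m : ℕ} where

    infix 4 _⇝_

    _⇝_ : Ranking {k} → Ranking {k} → Set
    f ⇝ g = ∃[ w ] Good m f w g

    -- A killed state may receive an arbitrary rank, because no path leaves it.
    kill-step : ∀ {f h} x v → v < 2 * m → Tight m f →
      (∀ j → j < m → ∃[ u ] u ≢ x × f u ≡ 2 * j + 1) →
      Tight m (updateAt f x (const v)) × (updateAt f x (const v) ⇝ h → f ⇝ h)
    kill-step {f} {h} x v v<2m tight spare = tight′ , step
      where
      f′ : Ranking
      f′ = updateAt f x (const v)

      tight′ : Tight m f′
      tight′ .bounded s with s ≟ x
      ... | yes refl = subst (_< 2 * m) (sym (updateAt-updates x f)) v<2m
      ... | no s≢x   = subst (_< 2 * m) (sym (updateAt-minimal s x f s≢x)) (tight .bounded s)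
      tight′ .onto j j<m = let u , u≢x , eq = spare j j<m in
        u , ≡-trans (updateAt-minimal u x f u≢x) eq

      step : f′ ⇝ h → f ⇝ h
      step (w , G) with mix m f | kill-word x
      ... | w₁ , M | w₂ , kill-descends , kill-path =
        -- Mixing first lets a path that starts in `x` move to a spare state of any odd rank up to
        -- `f x` before `x` is killed.
        w₁ ++ w₂ ++ w , good-bridge M
          (kill-descends λ s s≢x → ≤-reflexive (updateAt-minimal s x f s≢x))
          (λ j j<m → let u , u≢x , eq = spare j j<m in
            u , u , eq , ≡-trans (updateAt-minimal u x f u≢x) eq , false , kill-path u≢x)
          G

    swap-step : ∀ {f h x y} → Tight m f → (τ : Transposition x y) →
      Tight m (f ∘ Transposition.τ τ) × (f ∘ Transposition.τ τ ⇝ h → f ⇝ h)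
    swap-step {f} {h} tight T = tight′ , step
      where
      open Transposition T

      tight′ : Tight m (f ∘ τ)
      tight′ .bounded s = tight .bounded (τ s)
      tight′ .onto j j<m = let u , eq = tight .onto j j<m in τ u , ≡-trans (cong f (involutive u)) eq

      step : f ∘ τ ⇝ h → f ⇝ h
      step (w , G) with mix m f
      ... | w₁ , M = w₁ ++ word ++ w , good-bridge M (Transposition.descends T f)
        (λ j j<m → let u , eq = tight .onto j j<m in
          u , τ u , eq , ≡-trans (cong f (involutive u)) eq , false , path u)
        G

  module _ {m : ℕ} {g : Ranking {k}} (tight-g : Tight m g) where

    private
      rep : ∀ j → j < m → Fin (suc k)
      rep j j<m = proj₁ (tight-g .onto j j<m)

      g-rep : ∀ j j<m → g (rep j j<m) ≡ 2 * j + 1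
      g-rep j j<m = proj₂ (tight-g .onto j j<m)

    -- The states in `xs` are those where `f` may still differ from `g`; they are killed and given
    -- their final rank one at a time. The representatives already agree with `g`, so they are never
    -- killed and supply a spare state for each odd rank.
    overwrite : ∀ xs {f} → Tight m f → (∀ j j<m → f (rep j j<m) ≡ 2 * j + 1) →
                (∀ s → s ∈ xs ⊎ f s ≡ g s) → _⇝_ {m} f g
    overwrite [] {f} tight-f f-rep agree with mix m f
    ... | w , G = w , good-≗ f≗g G
      where
      f≗g : f ≗ g
      f≗g s with agree s
      ... | inj₂ eq = eq
    overwrite (x ∷ xs) {f} tight-f f-rep agree with f x ℕ.≟ g x
    ... | yes fx≡gx = overwrite xs tight-f f-rep agree′
      where
      agree′ : ∀ s → s ∈ xs ⊎ f s ≡ g s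
      agree′ s with agree s
      ... | inj₁ (here refl) = inj₂ fx≡gx
      ... | inj₁ (there s∈)  = inj₁ s∈
      ... | inj₂ eq          = inj₂ eq
    ... | no fx≢gx = proj₂ step (overwrite xs (proj₁ step)
        (λ j j<m → ≡-trans (updateAt-minimal _ x f (rep≢x j j<m)) (f-rep j j<m)) agree′)
      where
      rep≢x : ∀ j j<m → rep j j<m ≢ x
      rep≢x j j<m refl = fx≢gx (≡-trans (f-rep j j<m) (sym (g-rep j j<m)))

      step = kill-step {h = g} x (g x) (tight-g .bounded x) tight-f
        (λ j j<m → rep j j<m , rep≢x j j<m , f-rep j j<m)

      agree′ : ∀ s → s ∈ xs ⊎ updateAt f x (const (g x)) s ≡ g s
      agree′ s with s ≟ x
      ... | yes refl = inj₂ (updateAt-updates x f)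
      ... | no s≢x with agree s
      ...   | inj₁ (here s≡x) = contradiction s≡x s≢x
      ...   | inj₁ (there s∈) = inj₁ s∈
      ...   | inj₂ eq         = inj₂ (≡-trans (updateAt-minimal s x f s≢x) eq)

    Aligned : Ranking {k} → ℕ → Set
    Aligned f j = ∀ i (i<m : i < m) → i < j → f (rep i i<m) ≡ 2 * i + 1

    -- Here `d` odd ranks remain to be placed. A state `u` of rank `2 * j + 1` is exchanged with the
    -- representative of that rank. Earlier representatives are unaffected: they differ from `u` by
    -- their rank under `f` and from the new representative by their rank under `g`.
    align : ∀ d j → d + j ≡ m → ∀ {f} → Tight m f →
            Aligned f j → _⇝_ {m} f g
    align zero j refl tight-f f-rep =
      overwrite (allFin _) tight-f (λ i i<m → f-rep i i<m i<m) (λ s → inj₁ (∈-allFin s))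
    align (suc d) j d+j≡m {f} tight-f f-rep with tight-f .onto j j<m
      where
      j<m : j < m
      j<m = subst (j <_) d+j≡m (s≤s (m≤n+m j d))
    ... | u , fu≡r = go (u ≟ rep j j<m)
      where
      j<m : j < m
      j<m = subst (j <_) d+j≡m (s≤s (m≤n+m j d))

      next : ∀ {f} → f (rep j j<m) ≡ 2 * j + 1 → Aligned f j → Aligned f (suc j)
      next eq eqs i i<m i<1+j with m<1+n⇒m<n∨m≡n i<1+j
      ... | inj₁ i<j  = eqs i i<m i<j
      -- The representative depends on the proof of the bound, so the two proofs have to be
      -- identified.
      ... | inj₂ refl rewrite <-irrelevant i<m j<m = eq

      odd-injective : ∀ {i} → 2 * i + 1 ≡ 2 * j + 1 → i ≡ j
      odd-injective eq = *-cancelˡ-≡ _ _ 2 (+-cancelʳ-≡ 1 _ _ eq)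

      go : _ → _⇝_ {m} f g
      go (yes refl) = align d (suc j) (≡-trans (+-suc d j) d+j≡m) tight-f (next {f} fu≡r f-rep)
      go (no u≢rep) = proj₂ step (align d (suc j) (≡-trans (+-suc d j) d+j≡m) (proj₁ step)
          (next {f ∘ τ} (≡-trans (cong f τ-right) fu≡r) λ i i<m i<j →
            ≡-trans (cong f (τ-other (rep≢u i i<m i<j) (rep≢rep i i<m i<j))) (f-rep i i<m i<j)))
        where
        open Transposition (transposition u≢rep)
        step = swap-step {h = g} tight-f (transposition u≢rep)

        rep≢u : ∀ i i<m → i < j → rep i i<m ≢ u
        rep≢u i i<m i<j refl = <⇒≢ i<j (odd-injective (≡-trans (sym (f-rep i i<m i<j)) fu≡r))

        rep≢rep : ∀ i i<m → i < j → rep i i<m ≢ rep j j<m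
        rep≢rep i i<m i<j eq = <⇒≢ i<j (odd-injective
          (≡-trans (sym (g-rep i i<m)) (≡-trans (cong g eq) (g-rep j j<m))))

  connect : ∀ {m f g} → Tight m f → Tight m g → ∃[ w ] Good m f w g
  connect {m} tight-f tight-g = align tight-g m 0 (+-identityʳ m) tight-f λ _ _ ()

bounds-odd : ∀ y → ∃[ j ] 2 * j ≤ y × y ≤ 2 * j + 1
bounds-odd y = y / 2 , (begin
    2 * (y / 2)            ≡⟨ *-comm 2 (y / 2) ⟩
    y / 2 * 2              ≤⟨ m≤n+m _ (y % 2) ⟩
    y % 2 + y / 2 * 2      ≡⟨ m≡m%n+[m/n]*n y 2 ⟨
    y                      ∎) , (begin
    y                      ≡⟨ m≡m%n+[m/n]*n y 2 ⟩
    y % 2 + y / 2 * 2      ≤⟨ +-monoˡ-≤ _ (s≤s⁻¹ (m%n<n y 2)) ⟩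
    1 + y / 2 * 2          ≡⟨ +-comm 1 _ ⟩
    y / 2 * 2 + 1          ≡⟨ cong (_+ 1) (*-comm (y / 2) 2) ⟩
    2 * (y / 2) + 1        ∎)
  where open ≤-Reasoning

-- One of `y` and `y + 1` is odd, and both are at most `x`.
odd-between : ∀ {m x y} → y < x → x < 2 * m → ∃[ j ] j < m × y ≤ 2 * j + 1 × 2 * j + 1 ≤ x
odd-between {m} {x} {y} y<x x<2m with bounds-odd y
... | j , 2j≤y , y≤2j+1 = j , *-cancelˡ-< 2 j m (≤-<-trans 2j≤y (<-trans y<x x<2m)) , y≤2j+1 ,
  ≤-trans (≤-reflexive (+-comm (2 * j) 1)) (≤-trans (s≤s 2j≤y) y<x)

-- The complementation bound

module _ {σ : ℕ} where

  lasso : List⁺ (Fin σ) → List⁺ (Fin σ) → ℕ → List⁺ (Fin σ)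
  lasso u v zero    = u
  lasso u v (suc _) = v

  -- The block at `j` is excluded. The order `<′` provides the recursion on the right end and,
  -- through its base case, a nonempty result.
  segment : (ℕ → List⁺ (Fin σ)) → ∀ {i j} → i <′ j → List⁺ (Fin σ)
  segment W {i} (≤′-reflexive _)   = W i
  segment W {i} (≤′-step {n} i<n)  = segment W i<n ⁺++⁺ W n

module _ {σ} {A : NBW σ} where

  lasso-accepts : ∀ {u v b r s} → initial A r ≡ true → Path A (toList u) b r s →
                  Path A (toList v) true s s → BlockAccepts A (lasso u v)
  lasso-accepts {u} {v} {b} {r} {s} init p loop = q , flag , init , paths , λ i → suc i , n≤1+n i , refl
    where
    q : ℕ → Fin (states A)
    q zero    = r
    q (suc _) = s

    flag : ℕ → Bool
    flag zero    = b
    flag (suc _) = true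

    paths : ∀ i → Path A (toList (lasso u v i)) (flag i) (q i) (q (suc i))
    paths zero    = p
    paths (suc i) = loop

  segment-path : ∀ {W : ℕ → List⁺ (Fin σ)} {q : ℕ → Fin (states A)} {b : ℕ → Bool} → (∀ i → Path A (toList (W i)) (b i) (q i) (q (suc i))) →
    ∀ {i j} (i<j : i <′ j) → ∃[ c ] Path A (toList (segment W i<j)) c (q i) (q j)
      × (∀ l → i ≤ l → l < j → b l ≡ true → c ≡ true)
  segment-path {b = b} ps {i} (≤′-reflexive refl) = b i , ps i ,
    λ l i≤l l<1+i → subst (λ l → b l ≡ true → b i ≡ true) (≤-antisym i≤l (s≤s⁻¹ l<1+i)) λ eq → eq
  segment-path {b = b} ps (≤′-step {n} i<n) with segment-path ps i<n
  ... | c , p , visit = c ∨ b n , p ++ᴾ ps n , visit′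
    where
    visit′ : ∀ l → _ ≤ l → l < suc n → b l ≡ true → c ∨ b n ≡ true
    visit′ l i≤l l<1+n bl with m<1+n⇒m<n∨m≡n l<1+n
    ... | inj₁ l<n  = cong (_∨ b n) (visit l i≤l l<n bl)
    ... | inj₂ refl = ≡-trans (cong (c ∨_) bl) (∨-zeroʳ c)

module _ {k : ℕ} where

  open Tight
  open Good

  segment-good : ∀ {m W} {F : ℕ → Ranking {k}} → (∀ i → Tight m (F i)) →
    (∀ i → Good m (F i) (toList (W i)) (F (suc i))) →
    ∀ {i j} (i<j : i <′ j) → Good m (F i) (toList (segment W i<j)) (F j)
  segment-good tight good {i} (≤′-reflexive refl) = good i
  segment-good tight good (≤′-step {n} i<n)       = good-++ (tight n) (segment-good tight good i<n) (good n)

  good-rejects : ∀ {m W} {F : ℕ → Ranking {k}} →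
    (∀ i → Good m (F i) (toList (W i)) (F (suc i))) → ¬ Accepts (𝓑 k) (concatω W)
  good-rejects {m} {W} {F} good acc with Accepts⇒BlockAccepts acc
  ... | q , b , _ , paths , visits = impossible _ 0 ≤-refl
    where
    rank : ℕ → ℕ
    rank i = extend 0 (F i) (q i)

    antitone : ∀ {i j} → i ℕ.≤′ j → rank j ≤ rank i
    antitone (≤′-reflexive refl) = ≤-refl
    antitone (≤′-step {n} i≤n)   = ≤-trans (proj₁ (good n .descends (paths n))) (antitone i≤n)

    -- Induction on a bound `c` for the current rank: the next block with a visit pushes the rank
    -- strictly below `c`.
    impossible : ∀ c i → ¬ rank i ≤ c
    impossible c i rank≤c with visits i
    ... | j , i≤j , bj with <-≤-trans (proj₂ (good j .descends (paths j)) bj) (≤-trans (antitone (≤⇒≤′ i≤j)) rank≤c)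
    impossible (suc c) i rank≤c | j , _ , _ | rank<1+c = impossible c (suc j) (s≤s⁻¹ rank<1+c)

  -- Every state of `S'` is initial, so the run may start in a state of the largest odd rank. This
  -- bounds all ranks, so `u` leads from there to `s`. Since `h s < g s`, the word `v` leads from
  -- `s` back to `s` through the accepting state, and this can be repeated forever.
  good-accepts : ∀ {m u v} {f g h : Ranking {k}} → Tight m f → Tight m g → Good m f (toList u) g → Good m g (toList v) h →
    (∃[ s ] h s < g s) → Accepts (𝓑 k) (concatω (lasso u v))
  good-accepts {zero} tight-f _ _ _ _ with () ← tight-f .bounded zero
  good-accepts {suc m} {f = f} {g} tight-f tight-g G H (s , hs<gs)
    with tight-f .onto m ≤-refl | odd-between {suc m} hs<gs (tight-g .bounded s)
  ... | r , fr≡top | j , j<m , hs≤odd , odd≤gs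
    with G .reaches {r} {s} ≤-refl gs≤top (≤-reflexive (sym fr≡top)) | H .reaches j<m hs≤odd odd≤gs
    where
    gs≤top : g s ≤ 2 * m + 1
    gs≤top = s≤s⁻¹ (subst (g s <_) (≡-trans (*-suc 2 m) (cong suc (+-comm 1 (2 * m)))) (tight-g .bounded s))
  ...   | _ , p , _ | _ , loop , strict = BlockAccepts⇒Accepts
    (lasso-accepts refl p (castᴾ (strict hs<gs) loop))

  module _ {m L : ℕ} (r : Fin (suc L) → Ranking {k}) (tight : ∀ i → Tight m (r i))
           (ascends : ∀ {i j} → i Fin.< j → ∃[ s ] r i s < r j s) where

    private
      F : ℕ → Ranking
      F i = r (i mod suc L)

      -- The leading enterₗ only serves to make the block nonempty.
      W : ℕ → List⁺ (Fin 7)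
      W i = enterₗ ∷ proj₁ (connect (tight (i mod suc L)) (tight (suc i mod suc L)))

      W-good : ∀ i → Good m (F i) (toList (W i)) (F (suc i))
      W-good i = good-enter (proj₂ (connect (tight (i mod suc L)) (tight (suc i mod suc L))))

    ascending-family-bound : ComplementLowerBound (suc L) (𝓑 k)
    ascending-family-bound B complements with suc L ≤? states B
    ... | yes L≤ = L≤
    ... | no L≰ with Accepts⇒BlockAccepts (proj₂ (complements (concatω W)) (good-rejects W-good))
    ...   | q , b , init , paths , visits = contradiction
              (good-accepts (tight _) (tight _) (seg-good 0<tᵢ) (seg-good tᵢ<tⱼ) separated)
              (proj₁ (complements (concatω (lasso (segment W 0<tᵢ) (segment W tᵢ<tⱼ)))) B-accepts)
      where
      -- A time later than `i` and congruent to `c` modulo the number of rankings, so that for `c`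
      -- at most `L` the ranking of index `c` stands there.
      after : ℕ → ℕ → ℕ
      after c i = c + suc i * suc L

      after-< : ∀ c i → i < after c i
      after-< c i = ≤-trans (m≤m*n (suc i) (suc L)) (m≤n+m _ c)

      -- Visit the rankings in descending order, so that a segment between
      -- two of these times lowers the rank of some state; between
      -- consecutive ones the run of B visits an accepting state.
      time : ℕ → ℕ
      time zero    = after L 0
      time (suc i) = after (L ∸ suc i) (proj₁ (visits (time i)))

      ranking-at : ∀ i → toℕ (time i mod suc L) ≡ L ∸ i
      ranking-at i = ≡-trans (toℕ-fromℕ< _) (≡-trans (time-% i) (m<n⇒m%n≡m (s≤s (m∸n≤m L i))))
        where
        time-% : ∀ i → time i % suc L ≡ (L ∸ i) % suc L
        time-% zero    = [m+kn]%n≡m%n L 1 (suc L)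
        time-% (suc i) = [m+kn]%n≡m%n (L ∸ suc i) (suc (proj₁ (visits (time i)))) (suc L)

      time-visit : ∀ {i j} → i <′ j → ∃[ l ] time i ≤ l × l < time j × b l ≡ true
      time-visit {i} (≤′-reflexive refl) = let l , t≤l , bl = visits (time i) in
        l , t≤l , after-< (L ∸ suc i) l , bl
      time-visit (≤′-step {n} i<n) = let l , t≤l , l<t , bl = time-visit i<n ; l′ , t≤l′ , _ = visits (time n) in
        l , t≤l , <-trans (<-≤-trans l<t t≤l′) (after-< (L ∸ suc n) l′) , bl

      time-positive : ∀ i → 0 < time i
      time-positive zero    = ≤-<-trans z≤n (after-< L 0)
      time-positive (suc i) = ≤-<-trans z≤n (after-< (L ∸ suc i) (proj₁ (visits (time i))))

      collision = pigeonhole (≰⇒> L≰) (λ i → q (time (toℕ i)))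
      i j : Fin (suc L)
      i = proj₁ collision
      j = proj₁ (proj₂ collision)
      i<j : i Fin.< j
      i<j = proj₁ (proj₂ (proj₂ collision))
      same-state : q (time (toℕ i)) ≡ q (time (toℕ j))
      same-state = proj₂ (proj₂ (proj₂ collision))

      visit = time-visit (<⇒<′ i<j)

      0<tᵢ : 0 <′ time (toℕ i)
      0<tᵢ = <⇒<′ (time-positive (toℕ i))
      tᵢ<tⱼ : time (toℕ i) <′ time (toℕ j)
      tᵢ<tⱼ = <⇒<′ (≤-<-trans (proj₁ (proj₂ visit)) (proj₁ (proj₂ (proj₂ visit))))

      seg-good : ∀ {x y} (x<y : x <′ y) → Good m (F x) (toList (segment W x<y)) (F y)
      seg-good = segment-good {W = W} {F} (λ i → tight (i mod suc L)) W-good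

      separated : ∃[ s ] F (time (toℕ j)) s < F (time (toℕ i)) s
      -- Later times carry smaller indices, so `ascends` applies with the roles of `i` and `j`
      -- exchanged; `j` is at most `L`, which keeps the truncated subtraction strictly decreasing.
      separated = ascends (subst₂ _<_ (sym (ranking-at (toℕ j))) (sym (ranking-at (toℕ i)))
        (∸-monoʳ-< i<j (s≤s⁻¹ (toℕ<n j))))

      B-accepts : Accepts B (concatω (lasso (segment W 0<tᵢ) (segment W tᵢ<tⱼ)))
      B-accepts with segment-path {A = B} {W} {q} {b} paths 0<tᵢ | segment-path {A = B} {W} {q} {b} paths tᵢ<tⱼ
      ... | _ , p , _ | c , p′ , visited = BlockAccepts⇒Accepts (lasso-accepts init p
        (castᴾ (let l , t≤l , l<t , bl = visit in visited l t≤l l<t bl)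
          (subst (Path B _ c _) (sym same-state) p′)))

-- The Q(m)-rankings in lexicographic order

allL⇒All : ∀ {A : Set} (p : A → Bool) xs → T (allL p xs) → All (T ∘ p) xs
allL⇒All p []       _ = []
allL⇒All p (x ∷ xs) h = let px , pxs = Equivalence.to T-∧ h in px ∷ allL⇒All p xs pxs

anyL⇒Any : ∀ {A : Set} (p : A → Bool) xs → T (anyL p xs) → Any (T ∘ p) xs
anyL⇒Any p (x ∷ xs) h with Equivalence.to T-∨ h
... | inj₁ px  = here px
... | inj₂ pxs = there (anyL⇒Any p xs pxs)

rankingOf : ∀ {r n} → Vec (Fin r) n → Fin n → ℕ
rankingOf v s = toℕ (Vec.lookup v s)

isQRanking⇒Tight : ∀ {k m} (v : Vec (Fin (2 * m)) (suc k)) → T (isQRanking m v) → Tight m (rankingOf v)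
isQRanking⇒Tight v h .Tight.bounded s = toℕ<n (Vec.lookup v s)
isQRanking⇒Tight {m = m} v h .Tight.onto j j<m =
  index hit , ≡ᵇ⇒≡ _ _ (lookup-index hit)
  where
  hit = toList⁻ (anyL⇒Any _ (Vec.toList v) (All.lookup (allL⇒All _ (upTo m) h) (∈-upTo⁺ j<m)))

-- What lexicographic precedence leaves behind: the later vector is larger at the first place of
-- difference. The relation is not transitive in general, so it is stated for all pairs of a list
-- and not just for neighbours.
_≺_ : ∀ {r n} → Vec (Fin r) n → Vec (Fin r) n → Set
v ≺ w = ∃[ s ] rankingOf v s < rankingOf w s

-- The enumeration is lexicographic: vectors with the same head are separated in their tails by
-- induction, those with different heads at place 0.
allVecs-≺ : ∀ r n → AllPairs _≺_ (allVecs r n)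
allVecs-≺ r zero    = [] ∷ []
allVecs-≺ r (suc n) = AllPairsₚ.concat⁺
  (Allₚ.map⁺ (All.universal (λ x → AllPairsₚ.map⁺ (AllPairs.map (λ (s , lt) → suc s , lt) (allVecs-≺ r n))) (allFin r)))
  (AllPairsₚ.map⁺ (AllPairsₚ.tabulate⁺-< λ i<j →
    Allₚ.map⁺ (All.universal (λ v → Allₚ.map⁺ (All.universal (λ w → zero , i<j) _)) _)))

AllPairs-lookup : ∀ {A : Set} {R : A → A → Set} {xs} → AllPairs R xs →
                  ∀ {i j} → i Fin.< j → R (lookup xs i) (lookup xs j)
AllPairs-lookup (px ∷ _)  {zero}  {suc j} _         = All.lookup px (∈-lookup j)
AllPairs-lookup (_ ∷ pxs) {suc i} {suc j} (s≤s i<j) = AllPairs-lookup pxs i<j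

sorted-rankings-bound : ∀ k m (vs : List (Vec (Fin (2 * m)) (suc k))) → AllPairs _≺_ vs → All (T ∘ isQRanking m) vs →
               ComplementLowerBound (length vs) (𝓑 k)
sorted-rankings-bound k m []       _      _  B _ = z≤n
sorted-rankings-bound k m vs@(_ ∷ _) sorted qs = ascending-family-bound {m = m} (rankingOf ∘ lookup vs)
  (λ i → isQRanking⇒Tight {m = m} (lookup vs i) (All.lookup qs (∈-lookup i))) (AllPairs-lookup sorted)

Lnm-bound : ∀ k m → ComplementLowerBound (Lnm (suc (suc k)) m) (𝓑 k)
Lnm-bound k m = sorted-rankings-bound k m _ (AllPairsₚ.filter⁺ _ (allVecs-≺ (2 * m) (suc k)))
  (Allₚ.all-filter _ (allVecs (2 * m) (suc k)))

theorem4p9 : (n : ℕ) → 2 ≤ n →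
    Σ (NBW 7) (λ B → (states B ≡ n) × ComplementLowerBound (Ln n) B)
theorem4p9 (suc zero) (s≤s ())
theorem4p9 (suc (suc k)) _ = 𝓑 k , refl , λ B complements →
  -- The automaton does not depend on `m`, so the bounds for the single values of `m` combine into
  -- one for their maximum.
  foldr-preservesᵇ {P = _≤ states B} ⊔-lub z≤n
    (Allₚ.map⁺ (All.universal (λ i → Lnm-bound k (suc i) B complements) (upTo (suc k))))
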